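{- Let $A$ be a set of actions, let $e,f,g\in StExp(A)$ be such that $f{\downarrow}$ does not hold, and let $\Gamma:=\{e=f\cdot e+g\}$. Then there is an LLEE-witnessed coinductive proof over $\mathsf{Mil}^-+\Gamma$ of the equation $e=f^*\cdot g$.
   Context: **Star expressions and equational systems.** Star expressions over $A$, forming the set $StExp(A)$, are given by $e ::= 0 \mid 1 \mid a \mid (e_1+e_2)\mid (e_1\cdot e_2)\mid (e^*)$ with $a\in A$. $\equiv$ is syntactic equality. $Eq(A)$ is the set of formal equations $e=f$ with $e,f\in StExp(A)$. Immediate termination $e{\downarrow}$ is defined inductively: $1{\downarrow}$; $(e_1+e_2){\downarrow}$ if $e_1{\downarrow}$ or $e_2{\downarrow}$; $(e_1\cdot e_2){\downarrow}$ if $e_1{\downarrow}$ and $e_2{\downarrow}$; $(e^*){\downarrow}$ always. Finite sums $\sum_{i=1}^n e_i$ denote $0$ if $n=0$, $e_1$ if $n=1$, and $(\sum_{i=1}^{n-1}e_i)+e_n$ if $n>1$. An $\mathcal{EL}$-based system over $StExp(A)$ is a proof system whose formulas are the equations in $Eq(A)$ and whose rules include those of equational logic (reflexivity, symmetry, transitivity, closure under one-hole star expression contexts); it may have further axioms and rules. $e=_{\mathcal S}f$ means that $e=f$ is derivable in $\mathcal S$ without assumptions. $\mathsf{Mil}^-$ is the $\mathcal{EL}$-based system with only the rules of equational logic and the axiom schemes: $(e+f)+g=e+(f+g)$; $e+0=e$; $e+f=f+e$; $e+e=e$; $(e\cdot f)\cdot g=e\cdot(f\cdot g)$; $(e+f)\cdot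 g=e\cdot g+f\cdot g$; $1\cdot e=e$; $e\cdot 1=e$; $0\cdot e=0$; $e^*=1+e\cdot e^*$; $e^*=(1+e)^*$. For $\Gamma\subseteq Eq(A)$, $\mathsf{Mil}^-+\Gamma$ is $\mathsf{Mil}^-$ with the equations in $\Gamma$ added as axioms. **1-charts and LLEE.** A 1-chart is a tuple $\underline{C}=\langle V,A,1,v_s,\to,{\downarrow}\rangle$ with $V$ a finite set of vertices, $1\notin A$ the empty-step label, $v_s\in V$ the start vertex, ${\to}\subseteq V\times(A\cup\{1\})\times V$ a (finite) labeled transition relation, and ${\downarrow}\subseteq V$ the set of vertices with immediate termination. Transitions labeled in $A$ are proper; those labeled $1$ are 1-transitions. It is weakly guarded if it has no cycle of 1-transitions. A loop 1-chart is a 1-chart such that (L1) there is an infinite path from its start vertex, (L2) every infinite path from the start vertex returns to it after a positive number of transitions, (L3) only the start vertex may have immediate termination. For a vertex $v$ of $\underline C$ and a nonempty set $U$ of transitions from $v$, consider the sub-1-chart with start vertex $v$ consisting of all vertices and transitions on paths that start with a transition in $U$ and continue until $v$ is reached again (termination inherited from $\underline C$). If it is a loop 1-chart it is called a loop sub-1-chart of $\underline C$, with loop-entry transitions $U$; its remaining transitions are its loop-body transitions. Eliminating it from $\underline C$ means removing the transitions in $U$ and then all vertices and transitions that become unreachable from the start vertex. $\underline C$ is an LLEE-1-chart if there is a finite sequence $\underline C=\underline C_0,\dots,\underline C_n$ where $\underline C_i$ results from $\underline C_{i-1}$ by eliminating a loop sub-1-chart $L_i$ of $\underline{C}_{i-1}$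 with loop-entry transitions $U_i$, $\underline C_n$ has no infinite path, and for $i<j$ no transition in $U_j$ is a loop-body transition of $L_i$ (layeredness). **Coinductive proofs.** Let $\mathcal S$ be an $\mathcal{EL}$-based system containing the axioms for associativity, commutativity and idempotency of $+$. A function $s:V\to StExp(A)$ is an $\mathcal S$-provable solution of $\underline C$ if for every $v\in V$, with $\{v\xrightarrow{\underline a_i}v_i\mid 1\le i\le n\}$ a list of all transitions from $v$, it holds that $s(v)=_{\mathcal S}\tau(v)+\sum_{i=1}^n\underline a_i\cdot s(v_i)$, where $\tau(v)\equiv 1$ if $v\in{\downarrow}$ and $\tau(v)\equiv 0$ otherwise (the label $1$ being read as the star expression $1$). A coinductive proof over $\mathcal S$ of $e_1=e_2$ is a pair $\langle\underline C,L\rangle$ with $\underline C$ a weakly guarded 1-chart and $L:V\to Eq(A)$, $L(v)=(L_1(v)=L_2(v))$, such that $L_1$ and $L_2$ are $\mathcal S$-provable solutions of $\underline C$, and $e_1\equiv L_1(v_s)$, $e_2\equiv L_2(v_s)$. It is LLEE-witnessed if $\underline C$ is an LLEE-1-chart. -}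

module Defs where

open import Data.Bool using (if_then_else_)
open import Data.Fin using (Fin)
open import Data.List using (List; []; _∷_; foldl; map)
open import Data.List.Membership.Propositional using (_∈_)
open import Data.List.Relation.Unary.AllPairs using (AllPairs)
open import Data.Nat using (ℕ; zero; suc)
open import Data.Product using (Σ-syntax; ∃; ∃-syntax; _×_; _,_)
open import Data.Unit using (tt)
open import Function using (_∘_)
open import Function.Bundles using (_↔_; _⇔_)
open import Level using (0ℓ) renaming (suc to lsuc)
open import Relation.Binary.Construct.Closure.ReflexiveTransitive using (Star; ε; _◅_; _◅◅_)
open import Relation.Binary.Construct.Closure.Transitive using (TransClosure)
open import Relation.Binary.PropositionalEquality using (_≡_; _≢_)
open import Relation.Nullary using (¬_; does)
open import Relation.Unary using (Pred; Decidable; U; _∪_)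

variable
  A : Set

------------------------------------------------------------------------
-- Star expressions

infixl 6 _+_
infixl 7 _·_
infix  8 _*
infix  5 _≐_
infix  4 _↓

data StExp (A : Set) : Set where
  𝟎 𝟏 : StExp A
  act : A → StExp A
  _+_ : StExp A → StExp A → StExp A
  _·_ : StExp A → StExp A → StExp A
  _*  : StExp A → StExp A

data _↓ {A : Set} : StExp A → Set where
  𝟏↓  : 𝟏 ↓
  +↓ˡ : ∀ {e₁ e₂} → e₁ ↓ → e₁ + e₂ ↓
  +↓ʳ : ∀ {e₁ e₂} → e₂ ↓ → e₁ + e₂ ↓
  ·↓  : ∀ {e₁ e₂} → e₁ ↓ → e₂ ↓ → e₁ · e₂ ↓
  *↓  : ∀ {e} → e * ↓

-- Left-associated, and without a spurious summand 𝟎 when the list is nonempty.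
∑ : List (StExp A) → StExp A
∑ []       = 𝟎
∑ (e ∷ es) = foldl _+_ e es

record Eq (A : Set) : Set where
  constructor _≐_
  field
    lhs : StExp A
    rhs : StExp A

open Eq public

------------------------------------------------------------------------
-- Proof systems

data Context (A : Set) : Set where
  □    : Context A
  _+ˡ_ : Context A → StExp A → Context A
  _+ʳ_ : StExp A → Context A → Context A
  _·ˡ_ : Context A → StExp A → Context A
  _·ʳ_ : StExp A → Context A → Context A
  _*ᶜ  : Context A → Context A

_[_] : Context A → StExp A → StExp A
□        [ e ] = e
(C +ˡ f) [ e ] = C [ e ] + f
(f +ʳ C) [ e ] = f + C [ e ]
(C ·ˡ f) [ e ] = C [ e ] · f
(f ·ʳ C) [ e ] = f · C [ e ]
(C *ᶜ)   [ e ] = (C [ e ]) *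

infix 3 _⊢_

-- Derivability in equational logic with the equations in Ax as axioms.
data _⊢_ {A : Set} (Ax : Pred (Eq A) 0ℓ) : Eq A → Set where
  axiom    : ∀ {eq} → Ax eq → Ax ⊢ eq
  ⊢-refl   : ∀ {e} → Ax ⊢ e ≐ e
  ⊢-sym    : ∀ {e f} → Ax ⊢ e ≐ f → Ax ⊢ f ≐ e
  ⊢-trans  : ∀ {e f g} → Ax ⊢ e ≐ f → Ax ⊢ f ≐ g → Ax ⊢ e ≐ g
  ⊢-ctx    : ∀ {e f} (C : Context A) → Ax ⊢ e ≐ f → Ax ⊢ C [ e ] ≐ C [ f ]

data Mil⁻ {A : Set} : Pred (Eq A) 0ℓ where
  +-assoc  : ∀ e f g → Mil⁻ ((e + f) + g ≐ e + (f + g))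
  +-neut   : ∀ e     → Mil⁻ (e + 𝟎 ≐ e)
  +-comm   : ∀ e f   → Mil⁻ (e + f ≐ f + e)
  +-idem   : ∀ e     → Mil⁻ (e + e ≐ e)
  ·-assoc  : ∀ e f g → Mil⁻ ((e · f) · g ≐ e · (f · g))
  +-distʳ  : ∀ e f g → Mil⁻ ((e + f) · g ≐ e · g + f · g)
  ·-idˡ    : ∀ e     → Mil⁻ (𝟏 · e ≐ e)
  ·-idʳ    : ∀ e     → Mil⁻ (e · 𝟏 ≐ e)
  ·-zeroˡ  : ∀ e     → Mil⁻ (𝟎 · e ≐ 𝟎)
  *-unfold : ∀ e     → Mil⁻ (e * ≐ 𝟏 + e · e *)
  *-trm    : ∀ e     → Mil⁻ (e * ≐ (𝟏 + e) *)

Mil⁻+_ : Pred (Eq A) 0ℓ → Pred (Eq A) 0ℓ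
Mil⁻+ Γ = Mil⁻ ∪ Γ

------------------------------------------------------------------------
-- 1-charts

data Label (A : Set) : Set where
  one    : Label A
  proper : A → Label A

⌜_⌝ : Label A → StExp A
⌜ one ⌝      = 𝟏
⌜ proper a ⌝ = act a

-- The label set need not have decidable equality, so finiteness of the
-- transition relation means that the transitions from each of the (finitely
-- many) vertices can be listed, possibly with repetitions.  The subset of
-- terminating vertices is decidable, because τ below branches on it.
record 1-Chart (A : Set) : Set₁ where
  infix 4 _⟶⟨_⟩_
  field
    V        : Set
    V-finite : ∃[ n ] (V ↔ Fin n)
    start    : V
    _⟶⟨_⟩_   : V → Label A → V → Set
    Term     : Pred V 0ℓ
    Term?    : Decidable Term

  Lists : List (Label A × V) → V → Set
  Lists ts v = ∀ l w → ((l , w) ∈ ts) ⇔ (v ⟶⟨ l ⟩ w)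

  field
    ⟶-finite : ∀ v → ∃[ ts ] Lists ts v

  WeaklyGuarded : Set
  WeaklyGuarded = ∀ v → ¬ TransClosure (_⟶⟨ one ⟩_) v v

-- Classes of transitions are predicates on triples.
module LLEE (C : 1-Chart A) where
  open 1-Chart C

  TransitionSet : Set₁
  TransitionSet = V → Label A → V → Set

  -- A 1-chart obtained from C by restricting the vertices and transitions and
  -- choosing a new start vertex; its terminating vertices are those of C.
  record SubChart : Set₁ where
    field
      Vertex  : Pred V 0ℓ
      origin  : V
      Trans   : TransitionSet
      origin∈ : Vertex origin
      source∈ : ∀ {x l y} → Trans x l y → Vertex x
      target∈ : ∀ {x l y} → Trans x l y → Vertex y
      trans⊆  : ∀ {x l y} → Trans x l y → x ⟶⟨ l ⟩ y

  open SubChart public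

  whole : SubChart
  whole = record
    { Vertex = U ; origin = start ; Trans = _⟶⟨_⟩_
    ; origin∈ = tt ; source∈ = λ _ → tt ; target∈ = λ _ → tt ; trans⊆ = λ t → t }

  record InfinitePath (D : SubChart) : Set where
    field
      vertex : ℕ → V
      label  : ℕ → Label A
      step   : ∀ i → Trans D (vertex i) (label i) (vertex (suc i))

  open InfinitePath public

  record IsLoop (D : SubChart) : Set where
    field
      L1 : Σ[ p ∈ InfinitePath D ] vertex p 0 ≡ origin D
      L2 : (p : InfinitePath D) → vertex p 0 ≡ origin D →
           ∃[ k ] vertex p (suc k) ≡ origin D
      L3 : ∀ x → Vertex D x → Term x → x ≡ origin D

  -- A nonempty set of transitions of D from the vertex v.
  record Entries (D : SubChart) : Set₁ where
    field
      v        : V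
      Entry    : TransitionSet
      nonempty : ∃[ l ] ∃[ w ] Entry v l w
      from-v   : ∀ {x l y} → Entry x l y → x ≡ v
      entry⊆   : ∀ {x l y} → Entry x l y → Trans D x l y

  -- The sub-1-chart of D generated by the paths that start with a transition
  -- in Entry and continue until v is reached again.  This includes the paths
  -- that never return to v.
  module _ (D : SubChart) (E : Entries D) where
    open Entries E

    data Visited : V → Set where
      at-v  : Visited v
      enter : ∀ {l w} → Entry v l w → Visited w
      next  : ∀ {x l y} → Visited x → x ≢ v → Trans D x l y → Visited y

    data OnPath : V → Label A → V → Set where
      first : ∀ {l w} → Entry v l w → OnPath v l w
      later : ∀ {x l y} → Visited x → x ≢ v → Trans D x l y → OnPath x l y

    private
      src : ∀ {x l y} → OnPath x l y → Visited x
      src (first _)     = at-v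
      src (later r _ _) = r

      tgt : ∀ {x l y} → OnPath x l y → Visited y
      tgt (first u)       = enter u
      tgt (later r x≢v t) = next r x≢v t

      inD : ∀ {x l y} → OnPath x l y → Trans D x l y
      inD (first u)     = entry⊆ u
      inD (later _ _ t) = t

    generated : SubChart
    generated = record
      { Vertex = Visited ; origin = v ; Trans = OnPath
      ; origin∈ = at-v ; source∈ = src ; target∈ = tgt
      ; trans⊆ = λ t → trans⊆ D (inD t) }

  record LoopSub (D : SubChart) : Set₁ where
    field
      entries : Entries D
      isLoop  : IsLoop (generated D entries)

    EntryTrans : TransitionSet
    EntryTrans = Entries.Entry entries

    BodyTrans : TransitionSet
    BodyTrans x l y = Trans (generated D entries) x l y × ¬ EntryTrans x l y

  open LoopSub public

  -- Removing the loop-entry transitions, and then keeping only what is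
  -- reachable from the start vertex.
  module _ (D : SubChart) (L : LoopSub D) where

    Kept : TransitionSet
    Kept x l y = Trans D x l y × ¬ EntryTrans L x l y

    Reachable : Pred V 0ℓ
    Reachable = Star (λ x y → ∃[ l ] Kept x l y) (origin D)

    eliminate : SubChart
    eliminate = record
      { Vertex  = Reachable
      ; origin  = origin D
      ; Trans   = λ x l y → Reachable x × Kept x l y
      ; origin∈ = ε
      ; source∈ = λ (r , _) → r
      ; target∈ = λ (r , k) → r ◅◅ ((_ , k) ◅ ε)
      ; trans⊆  = λ (_ , t , _) → trans⊆ D t }

  infixr 5 _∷_

  data Eliminations : SubChart → SubChart → Set₁ where
    []  : ∀ {D} → Eliminations D D
    _∷_ : ∀ {D D′} (L : LoopSub D) → Eliminations (eliminate D L) D′ →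
          Eliminations D D′

  loops : ∀ {D D′} → Eliminations D D′ → List (∃ LoopSub)
  loops []            = []
  loops (_∷_ {D} L s) = (D , L) ∷ loops s

  -- No loop-entry transition of the second loop, which is eliminated later,
  -- is a loop-body transition of the first.
  NoEntryInBody : ∃ LoopSub → ∃ LoopSub → Set
  NoEntryInBody (_ , Lᵢ) (_ , Lⱼ) = ∀ {x l y} → EntryTrans Lⱼ x l y → ¬ BodyTrans Lᵢ x l y

  Layered : ∀ {D D′} → Eliminations D D′ → Set₁
  Layered s = AllPairs NoEntryInBody (loops s)

IsLLEE : 1-Chart A → Set₁
IsLLEE C = ∃[ D ] Σ[ s ∈ Eliminations whole D ] (¬ InfinitePath D × Layered s)
  where open LLEE C

------------------------------------------------------------------------
-- Coinductive proofs

module _ (C : 1-Chart A) where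
  open 1-Chart C

  τ : V → StExp A
  τ v = if does (Term? v) then 𝟏 else 𝟎

  -- A proof system enters only through its derivable equations.  The list of
  -- transitions from v is arbitrary; in a system with associativity,
  -- commutativity and idempotency of + any one such list is as good as another.
  IsSolution : Pred (Eq A) 0ℓ → (V → StExp A) → Set
  IsSolution Derivable s = ∀ v ts → Lists ts v →
    Derivable (s v ≐ τ v + ∑ (map (λ (l , w) → ⌜ l ⌝ · s w) ts))

record CoinductiveProof {A : Set} (Derivable : Pred (Eq A) 0ℓ) (eq : Eq A) : Set₁ where
  field
    chart : 1-Chart A

  open 1-Chart chart

  field
    weaklyGuarded : WeaklyGuarded
    L             : V → Eq A
    solution₁     : IsSolution chart Derivable (lhs ∘ L)
    solution₂     : IsSolution chart Derivable (rhs ∘ L)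
    conclusion₁   : lhs eq ≡ lhs (L start)
    conclusion₂   : rhs eq ≡ rhs (L start)

LLEE-witnessed : {Derivable : Pred (Eq A) 0ℓ} {eq : Eq A} →
                 CoinductiveProof Derivable eq → Set₁
LLEE-witnessed P = IsLLEE (CoinductiveProof.chart P)

{-# OPTIONS --safe #-}
module Submission where

-- Both e and f * · g solve x = f · x + g, so it suffices to find an LLEE-1-chart
-- with a solution for every such x.  Its vertices are the occurrences of
-- subexpressions of f * · g; a vertex is solved by its subexpression times the
-- solution at the vertex where control continues, so that the solution at the
-- vertex of f * can be chosen freely among the solutions of x = f · x + g.
-- For the chart to be weakly guarded and LLEE, f and g are first rewritten in Mil⁻
-- such that bodies of stars do not terminate immediately, but can terminate
-- eventually (otherwise, they are not on a loop).  If f itself cannot terminate,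
-- then f · x = f, and no loop is needed.

open import Defs
open import Data.Empty using (⊥-elim)
open import Data.Fin using (Fin)
open import Data.Fin.Properties using (+↔⊎; 1↔⊤; inj⇒≟)
open import Data.List using (List; []; _∷_; foldl; foldr; map)
open import Data.List.Membership.Propositional using (_∈_)
open import Data.List.Relation.Unary.All as All using (All; []; _∷_)
open import Data.List.Relation.Unary.AllPairs using ([]; _∷_)
open import Data.List.Relation.Unary.Any as Any using (Any; here; there)
open import Data.Nat as ℕ using (ℕ; zero; suc; _⊔_; _<_; _≤_; s≤s)
import Data.Nat.Properties as ℕ
open import Data.Product using (Σ-syntax; ∃; ∃-syntax; _×_; _,_; proj₁; proj₂)
open import Data.Sum using (_⊎_; inj₁; inj₂; [_,_]′)
open import Data.Sum.Function.Propositional using (_⊎-↔_)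
open import Data.Sum.Properties using (inj₁-injective; inj₂-injective)
open import Data.Unit using (⊤; tt)
open import Function using (_∘_; id; const)
open import Function.Bundles using (_↔_; mk⇔; module Equivalence)
open import Function.Construct.Composition using (_↔-∘_)
open import Function.Construct.Symmetry using (↔-sym)
open import Function.Properties.Inverse using (↔⇒↣)
open import Level using (0ℓ)
open import Relation.Binary.Bundles using (Setoid)
open import Relation.Binary.Construct.Closure.ReflexiveTransitive as Star using (Star; ε; _◅_; _◅◅_)
open import Relation.Binary.Construct.Closure.Transitive using (TransClosure; [_]; _∷_)
open import Relation.Binary.Definitions using (DecidableEquality)
open import Relation.Binary.PropositionalEquality using (_≡_; _≢_; refl; sym; trans; cong; cong₂; subst; subst₂)
import Relation.Binary.Reasoning.Setoid as SetoidReasoning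
open import Relation.Nullary using (¬_; Dec; yes; no)
open import Relation.Nullary.Decidable using (_×-dec_; _⊎-dec_; map′)
open import Relation.Unary using (Pred; ｛_｝)

-- Normal expressions

_↓? : (x : StExp A) → Dec (x ↓)
𝟎 ↓? = no λ ()
𝟏 ↓? = yes 𝟏↓
act _ ↓? = no λ ()
(x + y) ↓? = map′ [ +↓ˡ , +↓ʳ ]′ (λ { (+↓ˡ p) → inj₁ p ; (+↓ʳ p) → inj₂ p }) (x ↓? ⊎-dec y ↓?)
(x · y) ↓? = map′ (λ (p , q) → ·↓ p q) (λ { (·↓ p q) → p , q }) (x ↓? ×-dec y ↓?)
(_ *) ↓? = yes *↓

-- x can terminate after finitely many steps.
data Exits {A : Set} : StExp A → Set where
  𝟏   : Exits 𝟏
  act : ∀ {a} → Exits (act a)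
  inˡ : ∀ {x y} → Exits x → Exits (x + y)
  inʳ : ∀ {x y} → Exits y → Exits (x + y)
  _·_ : ∀ {x y} → Exits x → Exits y → Exits (x · y)
  _*  : ∀ {x} → Exits (x *)

exits? : (x : StExp A) → Dec (Exits x)
exits? 𝟎 = no λ ()
exits? 𝟏 = yes 𝟏
exits? (act _) = yes act
exits? (x + y) = map′ [ inˡ , inʳ ]′ (λ { (inˡ p) → inj₁ p ; (inʳ p) → inj₂ p }) (exits? x ⊎-dec exits? y)
exits? (x · y) = map′ (λ (p , q) → p · q) (λ { (p · q) → p , q }) (exits? x ×-dec exits? y)
exits? (_ *) = yes _*

↓⇒Exits : {x : StExp A} → x ↓ → Exits x
↓⇒Exits 𝟏↓ = 𝟏
↓⇒Exits (+↓ˡ p) = inˡ (↓⇒Exits p)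
↓⇒Exits (+↓ʳ p) = inʳ (↓⇒Exits p)
↓⇒Exits (·↓ p q) = ↓⇒Exits p · ↓⇒Exits q
↓⇒Exits *↓ = _*

-- The condition in `mul` makes the second factor reachable from the first, so its loops can still
-- be found when their turn comes. In `star`, `¬ (x ↓)` prevents cycles of 1-transitions, and
-- `Exits x` provides a way back from the body.
data Normal {A : Set} : StExp A → Set where
  𝟎   : Normal 𝟎
  𝟏   : Normal 𝟏
  act : ∀ {a} → Normal (act a)
  _+_ : ∀ {x y} → Normal x → Normal y → Normal (x + y)
  mul : ∀ {x y} → Exits x → Normal x → Normal y → Normal (x · y)
  star : ∀ {x} → ¬ (x ↓) → Exits x → Normal x → Normal (x *)

-- Derivability over `Mil⁻` and normal forms

module Provability {A : Set} (Γ : Pred (Eq A) 0ℓ) where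

  infix 4 _≈_
  _≈_ : StExp A → StExp A → Set
  x ≈ y = (Mil⁻+ Γ) ⊢ x ≐ y

  setoid : Setoid 0ℓ 0ℓ
  setoid = record
    { Carrier = StExp A
    ; _≈_ = _≈_
    ; isEquivalence = record { refl = ⊢-refl ; sym = ⊢-sym ; trans = ⊢-trans } }

  open SetoidReasoning setoid

  mil : ∀ {eq} → Mil⁻ eq → (Mil⁻+ Γ) ⊢ eq
  mil ax = axiom (inj₁ ax)

  +-congˡ : ∀ {x y z} → y ≈ z → x + y ≈ x + z
  +-congˡ {x} = ⊢-ctx (x +ʳ □)

  +-congʳ : ∀ {x y z} → y ≈ z → y + x ≈ z + x
  +-congʳ {x} = ⊢-ctx (□ +ˡ x)

  +-cong : ∀ {x y z w} → x ≈ y → z ≈ w → x + z ≈ y + w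
  +-cong p q = ⊢-trans (+-congʳ p) (+-congˡ q)

  ·-cong : ∀ {x y z w} → x ≈ y → z ≈ w → x · z ≈ y · w
  ·-cong {y = y} {z} p q = ⊢-trans (⊢-ctx (□ ·ˡ z) p) (⊢-ctx (y ·ʳ □) q)

  *-cong : ∀ {x y} → x ≈ y → x * ≈ y *
  *-cong = ⊢-ctx (□ *ᶜ)

  +-interchange : ∀ x y z w → (x + y) + (z + w) ≈ (x + z) + (y + w)
  +-interchange x y z w = begin
    (x + y) + (z + w) ≈⟨ mil (+-assoc x y (z + w)) ⟩
    x + (y + (z + w)) ≈⟨ +-congˡ (mil (+-assoc y z w)) ⟨
    x + ((y + z) + w) ≈⟨ +-congˡ (+-congʳ (mil (+-comm y z))) ⟩
    x + ((z + y) + w) ≈⟨ +-congˡ (mil (+-assoc z y w)) ⟩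
    x + (z + (y + w)) ≈⟨ mil (+-assoc x z (y + w)) ⟨
    (x + z) + (y + w) ∎

  -- Since `x` absorbs `𝟏`, distributivity exposes `y` as a summand of `x · y`; a `𝟏` in `y` can
  -- then be absorbed as well.
  𝟏+·-unfold : ∀ {x y} → 𝟏 + x ≈ x → 𝟏 + x · y ≈ (𝟏 + y) + x · y
  𝟏+·-unfold {x} {y} p = begin
    𝟏 + x · y             ≈⟨ +-congˡ (·-cong p ⊢-refl) ⟨
    𝟏 + (𝟏 + x) · y       ≈⟨ +-congˡ (mil (+-distʳ 𝟏 x y)) ⟩
    𝟏 + (𝟏 · y + x · y)   ≈⟨ +-congˡ (+-congʳ (mil (·-idˡ y))) ⟩
    𝟏 + (y + x · y)       ≈⟨ mil (+-assoc 𝟏 y (x · y)) ⟨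
    (𝟏 + y) + x · y       ∎

  ↓⇒absorbs-𝟏 : ∀ {x} → x ↓ → 𝟏 + x ≈ x
  ↓⇒absorbs-𝟏 𝟏↓ = mil (+-idem 𝟏)
  ↓⇒absorbs-𝟏 (+↓ˡ {x} {y} p) =
    ⊢-trans (⊢-sym (mil (+-assoc 𝟏 x y))) (+-congʳ (↓⇒absorbs-𝟏 p))
  ↓⇒absorbs-𝟏 (+↓ʳ {x} {y} p) = begin
    𝟏 + (x + y) ≈⟨ +-congˡ (mil (+-comm x y)) ⟩
    𝟏 + (y + x) ≈⟨ mil (+-assoc 𝟏 y x) ⟨
    (𝟏 + y) + x ≈⟨ +-congʳ (↓⇒absorbs-𝟏 p) ⟩
    y + x       ≈⟨ mil (+-comm y x) ⟩
    x + y       ∎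
  ↓⇒absorbs-𝟏 (·↓ {x} {y} p q) = begin
    𝟏 + x · y       ≈⟨ 𝟏+·-unfold (↓⇒absorbs-𝟏 p) ⟩
    (𝟏 + y) + x · y ≈⟨ +-congʳ (↓⇒absorbs-𝟏 q) ⟩
    y + x · y       ≈⟨ +-congʳ (mil (·-idˡ y)) ⟨
    𝟏 · y + x · y   ≈⟨ mil (+-distʳ 𝟏 x y) ⟨
    (𝟏 + x) · y     ≈⟨ ·-cong (↓⇒absorbs-𝟏 p) ⊢-refl ⟩
    x · y           ∎
  ↓⇒absorbs-𝟏 (*↓ {x}) = begin
    𝟏 + x *             ≈⟨ +-congˡ (mil (*-unfold x)) ⟩
    𝟏 + (𝟏 + x · x *)   ≈⟨ mil (+-assoc 𝟏 𝟏 (x · x *)) ⟨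
    (𝟏 + 𝟏) + x · x *   ≈⟨ +-congʳ (mil (+-idem 𝟏)) ⟩
    𝟏 + x · x *         ≈⟨ mil (*-unfold x) ⟨
    x *                 ∎

  -- The first factor of a normal product exits, so deadness comes from the second. The induction
  -- moves `y` rightwards until it meets `𝟎`, which absorbs it from the left.
  dead-·ˡ : ∀ {x} → Normal x → ¬ Exits x → ∀ y → x · y ≈ x
  dead-·ˡ 𝟎 _ y = mil (·-zeroˡ y)
  dead-·ˡ 𝟏 d y = ⊥-elim (d 𝟏)
  dead-·ˡ act d y = ⊥-elim (d act)
  dead-·ˡ (_+_ {x₁} {x₂} n m) d y =
    ⊢-trans (mil (+-distʳ x₁ x₂ y)) (+-cong (dead-·ˡ n (d ∘ inˡ) y) (dead-·ˡ m (d ∘ inʳ) y))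
  dead-·ˡ (mul {x₁} {x₂} ex n m) d y =
    ⊢-trans (mil (·-assoc x₁ x₂ y)) (·-cong ⊢-refl (dead-·ˡ m (λ q → d (ex · q)) y))
  dead-·ˡ (star _ _ _) d y = ⊥-elim (d _*)

  -- Termination is tracked in one direction only: this direction carries `¬ (f ↓)` over to the
  -- normal form of `f`, which becomes the body of a star.
  record NormalForm (x : StExp A) : Set where
    field
      nf      : StExp A
      normal  : Normal nf
      nf≈     : nf ≈ x
      ↓-sound : nf ↓ → x ↓

  open NormalForm public

  product : ∀ {x y} → Normal x → Normal y → NormalForm (x · y)
  product {x} {y} n m with exits? x
  ... | yes ex = record { nf = x · y ; normal = mul ex n m ; nf≈ = ⊢-refl ; ↓-sound = id }
  ... | no  d  = record
    { nf = x ; normal = n ; nf≈ = ⊢-sym (dead-·ˡ n d y) ; ↓-sound = λ p → ⊥-elim (d (↓⇒Exits p)) }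

  -- y can replace x below a star, since x * ≈ (𝟏 + x) *.
  guard : ∀ {x} → Normal x → ∃[ y ] (Normal y × ¬ (y ↓) × 𝟏 + y ≈ 𝟏 + x)
  guard 𝟎 = 𝟎 , 𝟎 , (λ ()) , ⊢-refl
  guard 𝟏 = 𝟎 , 𝟎 , (λ ()) , ⊢-trans (mil (+-neut 𝟏)) (⊢-sym (mil (+-idem 𝟏)))
  guard act = _ , act , (λ ()) , ⊢-refl
  guard (_+_ {x₁} {x₂} n₁ n₂) with guard n₁ | guard n₂
  ... | y₁ , m₁ , g₁ , p₁ | y₂ , m₂ , g₂ , p₂ =
    y₁ + y₂ , m₁ + m₂ , (λ { (+↓ˡ p) → g₁ p ; (+↓ʳ p) → g₂ p }) , (begin
      𝟏 + (y₁ + y₂)         ≈⟨ +-congʳ (mil (+-idem 𝟏)) ⟨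
      (𝟏 + 𝟏) + (y₁ + y₂)   ≈⟨ +-interchange 𝟏 𝟏 y₁ y₂ ⟩
      (𝟏 + y₁) + (𝟏 + y₂)   ≈⟨ +-cong p₁ p₂ ⟩
      (𝟏 + x₁) + (𝟏 + x₂)   ≈⟨ +-interchange 𝟏 𝟏 x₁ x₂ ⟨
      (𝟏 + 𝟏) + (x₁ + x₂)   ≈⟨ +-congʳ (mil (+-idem 𝟏)) ⟩
      𝟏 + (x₁ + x₂)         ∎)
  guard (mul {x₁} {x₂} ex n₁ n₂) with x₁ ↓?
  ... | no g = x₁ · x₂ , mul ex n₁ n₂ , (λ { (·↓ p _) → g p }) , ⊢-refl
  ... | yes t with guard n₁ | guard n₂
  ...   | y₁ , m₁ , g₁ , p₁ | y₂ , m₂ , g₂ , p₂ =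
    -- As `x₁` terminates, it equals `𝟏 + y₁`, so `x₂` becomes a summand of its own and is guarded
    -- as `y₂`. The rest `y₁ · x₂` is guarded by `y₁`, but is normalised again because `y₁` may be
    -- dead although `x₁` exits.
    y₂ + nf P , m₂ + normal P , (λ { (+↓ˡ p) → g₂ p ; (+↓ʳ p) → product-guarded (↓-sound P p) }) , (begin
      𝟏 + (y₂ + nf P)             ≈⟨ mil (+-assoc 𝟏 y₂ (nf P)) ⟨
      (𝟏 + y₂) + nf P             ≈⟨ +-cong p₂ (nf≈ P) ⟩
      (𝟏 + x₂) + y₁ · x₂          ≈⟨ mil (+-assoc 𝟏 x₂ (y₁ · x₂)) ⟩
      𝟏 + (x₂ + y₁ · x₂)          ≈⟨ +-congˡ (+-congʳ (mil (·-idˡ x₂))) ⟨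
      𝟏 + (𝟏 · x₂ + y₁ · x₂)      ≈⟨ +-congˡ (mil (+-distʳ 𝟏 y₁ x₂)) ⟨
      𝟏 + (𝟏 + y₁) · x₂           ≈⟨ +-congˡ (·-cong (⊢-trans p₁ (↓⇒absorbs-𝟏 t)) ⊢-refl) ⟩
      𝟏 + x₁ · x₂                 ∎)
    where
      P = product m₁ n₂
      product-guarded : ¬ (y₁ · x₂ ↓)
      product-guarded (·↓ p _) = g₁ p
  guard (star {x} g ex n) =
    x · x * , mul ex n (star g ex n) , (λ { (·↓ p _) → g p }) ,
    ⊢-trans (⊢-sym (mil (*-unfold x))) (⊢-sym (↓⇒absorbs-𝟏 *↓))

  iteration : ∀ {x} → Normal x → NormalForm (x *)
  iteration {x} n with guard n
  ... | y , m , g , p with exits? y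
  ...   | yes ex = record
    { nf = y * ; normal = star g ex m ; nf≈ = y*≈x* ; ↓-sound = λ _ → *↓ }
    where
      y*≈x* : y * ≈ x *
      y*≈x* = ⊢-trans (mil (*-trm y)) (⊢-trans (*-cong p) (⊢-sym (mil (*-trm x))))
  -- A dead body is never completed, so `y · y *` collapses to `y` and one unfolding removes the
  -- star.
  ...   | no d = record
    { nf = 𝟏 + y ; normal = 𝟏 + m ; ↓-sound = λ _ → *↓
    ; nf≈ = begin
        𝟏 + y         ≈⟨ +-congˡ (dead-·ˡ m d (y *)) ⟨
        𝟏 + y · y *   ≈⟨ mil (*-unfold y) ⟨
        y *           ≈⟨ mil (*-trm y) ⟩
        (𝟏 + y) *     ≈⟨ *-cong p ⟩
        (𝟏 + x) *     ≈⟨ mil (*-trm x) ⟨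
        x *           ∎ }

  normalise : ∀ x → NormalForm x
  normalise 𝟎 = record { nf = 𝟎 ; normal = 𝟎 ; nf≈ = ⊢-refl ; ↓-sound = id }
  normalise 𝟏 = record { nf = 𝟏 ; normal = 𝟏 ; nf≈ = ⊢-refl ; ↓-sound = id }
  normalise (act a) = record { nf = act a ; normal = act ; nf≈ = ⊢-refl ; ↓-sound = id }
  normalise (x + y) = record
    { nf = nf X + nf Y ; normal = normal X + normal Y ; nf≈ = +-cong (nf≈ X) (nf≈ Y)
    ; ↓-sound = λ { (+↓ˡ p) → +↓ˡ (↓-sound X p) ; (+↓ʳ p) → +↓ʳ (↓-sound Y p) } }
    where X = normalise x ; Y = normalise y
  normalise (x · y) = record
    { nf = nf P ; normal = normal P ; nf≈ = ⊢-trans (nf≈ P) (·-cong (nf≈ X) (nf≈ Y))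
    ; ↓-sound = λ p → reflect (↓-sound P p) }
    where
      X = normalise x
      Y = normalise y
      P = product (normal X) (normal Y)
      reflect : nf X · nf Y ↓ → x · y ↓
      reflect (·↓ p q) = ·↓ (↓-sound X p) (↓-sound Y q)
  normalise (x *) = record
    { nf = nf I ; normal = normal I ; nf≈ = ⊢-trans (nf≈ I) (*-cong (nf≈ X)) ; ↓-sound = λ _ → *↓ }
    where
      X = normalise x
      I = iteration (normal X)

  -- Sums up to order and multiplicity

  sum : List (StExp A) → StExp A
  sum = foldr _+_ 𝟎

  +-neutˡ : ∀ x → 𝟎 + x ≈ x
  +-neutˡ x = ⊢-trans (mil (+-comm 𝟎 x)) (mil (+-neut x))

  foldl≈sum : ∀ x xs → foldl _+_ x xs ≈ x + sum xs
  foldl≈sum x [] = ⊢-sym (mil (+-neut x))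
  foldl≈sum x (y ∷ xs) = ⊢-trans (foldl≈sum (x + y) xs) (mil (+-assoc x y (sum xs)))

  ∑≈sum : ∀ xs → ∑ xs ≈ sum xs
  ∑≈sum [] = ⊢-refl
  ∑≈sum (x ∷ xs) = foldl≈sum x xs

  module _ {B : Set} (φ : B → StExp A) where

    sum-absorb : ∀ {z xs} → z ∈ xs → φ z + sum (map φ xs) ≈ sum (map φ xs)
    sum-absorb {z} {_ ∷ xs} (here refl) =
      ⊢-trans (⊢-sym (mil (+-assoc (φ z) (φ z) _))) (+-congʳ (mil (+-idem (φ z))))
    sum-absorb {z} {x ∷ xs} (there p) = begin
      φ z + (φ x + sum (map φ xs)) ≈⟨ mil (+-assoc (φ z) (φ x) _) ⟨
      (φ z + φ x) + sum (map φ xs) ≈⟨ +-congʳ (mil (+-comm (φ z) (φ x))) ⟩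
      (φ x + φ z) + sum (map φ xs) ≈⟨ mil (+-assoc (φ x) (φ z) _) ⟩
      φ x + (φ z + sum (map φ xs)) ≈⟨ +-congˡ (sum-absorb p) ⟩
      φ x + sum (map φ xs)         ∎

    sum-⊆ : ∀ xs {ys} → (∀ {z} → z ∈ xs → z ∈ ys) → sum (map φ xs) + sum (map φ ys) ≈ sum (map φ ys)
    sum-⊆ [] sub = +-neutˡ _
    sum-⊆ (x ∷ xs) sub =
      ⊢-trans (mil (+-assoc _ _ _)) (⊢-trans (+-congˡ (sum-⊆ xs (sub ∘ there))) (sum-absorb (sub (here refl))))

    -- Each sum absorbs the other. This handles the arbitrary transition lists in `IsSolution`,
    -- which may differ from `out` in order and repetitions.
    sum-≋ : ∀ {xs ys} → (∀ {z} → z ∈ xs → z ∈ ys) → (∀ {z} → z ∈ ys → z ∈ xs) →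
            sum (map φ xs) ≈ sum (map φ ys)
    sum-≋ {xs} {ys} xs⊆ys ys⊆xs = begin
      sum (map φ xs)                   ≈⟨ sum-⊆ ys ys⊆xs ⟨
      sum (map φ ys) + sum (map φ xs)  ≈⟨ mil (+-comm _ _) ⟩
      sum (map φ xs) + sum (map φ ys)  ≈⟨ sum-⊆ xs xs⊆ys ⟩
      sum (map φ ys)                   ∎

-- Elimination of nested loops

module Elimination {A : Set} (C : 1-Chart A)
  (_≟_ : DecidableEquality (1-Chart.V C)) (level : 1-Chart.V C → ℕ) where
  open 1-Chart C
  open LLEE C

  Down : TransitionSet
  Down x l y = x ⟶⟨ l ⟩ y × level y < level x

  _↘_ : V → V → Set
  x ↘ y = ∃[ l ] Down x l y

  ↘*⇒≥ : ∀ {x y} → Star _↘_ x y → level y ≤ level x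
  ↘*⇒≥ ε = ℕ.≤-refl
  ↘*⇒≥ ((_ , _ , y<x) ◅ p) = ℕ.≤-trans (↘*⇒≥ p) (ℕ.<⇒≤ y<x)

  record Loop : Set where
    field
      entry body : V

  open Loop public

  Enters : Loop → TransitionSet
  Enters ℓ x l y = x ≡ entry ℓ × l ≡ one × y ≡ body ℓ

  -- The invariant of the elimination: each transition lowers `level` or enters a loop not yet
  -- eliminated. Once the list is empty, all transitions descend and no infinite path is left.
  Remaining : List Loop → TransitionSet
  Remaining ls x l y = Down x l y ⊎ Any (λ ℓ → Enters ℓ x l y) ls

  _⇝[_]_ : V → List Loop → V → Set
  x ⇝[ ls ] y = Star (λ x y → ∃[ l ] Remaining ls x l y) x y

  -- ls are the loops that are eliminated after ℓ.
  record Eliminable (ℓ : Loop) (ls : List Loop) : Set₁ where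
    field
      Region    : Pred V 0ℓ
      entry∈    : Region (entry ℓ)
      body∈     : Region (body ℓ)
      closed    : ∀ {x l y} → Region x → x ≢ entry ℓ → x ⟶⟨ l ⟩ y → Region y
      nonterm   : ∀ {x} → Region x → ¬ Term x
      later∉    : All (λ ℓ′ → ¬ Region (entry ℓ′)) ls
      enters    : entry ℓ ⟶⟨ one ⟩ body ℓ
      returns   : Star _↘_ (body ℓ) (entry ℓ)
      reachable : start ⇝[ ℓ ∷ ls ] entry ℓ

  data Nested : List Loop → Set₁ where
    []  : Nested []
    _∷_ : ∀ {ℓ ls} → Eliminable ℓ ls → Nested ls → Nested (ℓ ∷ ls)

  Remaining⊆⟶ : ∀ {ls} → Nested ls → ∀ {x l y} → Remaining ls x l y → x ⟶⟨ l ⟩ y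
  Remaining⊆⟶ _ (inj₁ (t , _)) = t
  Remaining⊆⟶ (S ∷ _) (inj₂ (here (refl , refl , refl))) = Eliminable.enters S
  Remaining⊆⟶ (_ ∷ N) (inj₂ (there a)) = Remaining⊆⟶ N (inj₂ a)

  -- `complete` is confined to reachable sources because an elimination also discards what becomes
  -- unreachable.
  record Represents (D : SubChart) (ls : List Loop) : Set where
    field
      origin≡  : origin D ≡ start
      sound    : ∀ {x l y} → Trans D x l y → Remaining ls x l y
      complete : ∀ {x l y} → start ⇝[ ls ] x → Remaining ls x l y → Trans D x l y

  ∉-later : ∀ {R : Pred V 0ℓ} {ls x} → All (λ ℓ → ¬ R (entry ℓ)) ls →
            Any (λ ℓ → x ≡ entry ℓ) ls → ¬ R x
  ∉-later (r ∷ _) (here refl) = r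
  ∉-later (_ ∷ rs) (there a) = ∉-later rs a

  EntriesAmong : List Loop → ∃ LoopSub → Set
  EntriesAmong ls (_ , L) = ∀ x l y → EntryTrans L x l y → Any (λ ℓ → x ≡ entry ℓ) ls

  module Step {ℓ ls} (S : Eliminable ℓ ls) {D} (R : Represents D (ℓ ∷ ls)) where
    open Eliminable S
    open Represents R

    entrance : Entries D
    entrance = record
      { v = entry ℓ
      ; Entry = Enters ℓ
      ; nonempty = one , body ℓ , refl , refl , refl
      ; from-v = proj₁
      ; entry⊆ = λ { u@(refl , _) → complete reachable (inj₂ (here u)) } }

    -- `Region` bounds the generated sub-1-chart from above, so facts about the region (no
    -- termination, no entry of a later loop) carry over to it.
    visited⇒region : ∀ {x} → Visited D entrance x → Region x
    visited⇒region at-v = entry∈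
    visited⇒region (enter (_ , _ , refl)) = body∈
    visited⇒region (next r x≢v t) = closed (visited⇒region r) x≢v (trans⊆ D t)

    -- A transition that does not descend starts at `entry ℓ` or at the entry of a later loop; the
    -- latter lies outside the region.
    visited⇒down : ∀ {x l y} → Visited D entrance x → x ≢ entry ℓ → Trans D x l y → Down x l y
    visited⇒down r x≢v t with sound t
    ... | inj₁ d = d
    ... | inj₂ (here (x≡v , _)) = ⊥-elim (x≢v x≡v)
    ... | inj₂ (there a) = ⊥-elim (∉-later later∉ (Any.map proj₁ a) (visited⇒region r))

    onPath⇒down : ∀ {x l y} → x ≢ entry ℓ → OnPath D entrance x l y → Down x l y
    onPath⇒down ne (first (eq , _)) = ⊥-elim (ne eq)
    onPath⇒down ne (later r _ t) = visited⇒down r ne t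

    -- A state of the infinite path for `L1`: a vertex with a descending path back to the entry.
    -- When that path is used up, the loop is entered again; the reachability component gives access
    -- to `complete`.
    Position : Set
    Position = Σ[ x ∈ V ] Visited D entrance x × Star _↘_ x (entry ℓ) × start ⇝[ ℓ ∷ ls ] x

    advance : (s : Position) → Σ[ t ∈ Position ] ∃[ l ] OnPath D entrance (proj₁ s) l (proj₁ t)
    advance (_ , _ , ε , reach) =
      (body ℓ , enter u , returns , reach ◅◅ ((one , inj₂ (here u)) ◅ ε)) , one , first u
      where u = refl , refl , refl
    advance (x , r , (l , d) ◅ p , reach) =
      (_ , next r x≢v t , p , reach ◅◅ ((l , inj₁ d) ◅ ε)) , l , later r x≢v t
      where
        x≢v : x ≢ entry ℓ
        -- A descending step out of the entry ends strictly below it, from where no descending path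
        -- returns.
        x≢v refl = ℕ.<⇒≱ (proj₂ d) (↘*⇒≥ p)
        t = complete reach (inj₁ d)

    position : ℕ → Position
    position zero = entry ℓ , at-v , ε , reachable
    position (suc i) = proj₁ (advance (position i))

    cycle : InfinitePath (generated D entrance)
    cycle = record
      { vertex = proj₁ ∘ position
      ; label = λ i → proj₁ (proj₂ (advance (position i)))
      ; step = λ i → proj₂ (proj₂ (advance (position i))) }

    -- Away from the entry every step lowers the level, so the bound `n` cannot be used up before
    -- the entry is met. The search starts at index `suc i` because the return has to take a
    -- positive number of transitions.
    revisits : (p : InfinitePath (generated D entrance)) → ∀ n i → level (vertex p (suc i)) < n →
               ∃[ k ] vertex p (suc k) ≡ entry ℓ
    revisits p (suc n) i (s≤s below) with vertex p (suc i) ≟ entry ℓ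
    ... | yes eq = i , eq
    ... | no ne =
      revisits p n (suc i) (ℕ.<-≤-trans (proj₂ (onPath⇒down ne (step p (suc i)))) below)

    loopSub : LoopSub D
    loopSub = record
      { entries = entrance
      ; isLoop = record
        { L1 = cycle , refl
        ; L2 = λ p _ → revisits p _ 0 ℕ.≤-refl
        ; L3 = λ _ r term → ⊥-elim (nonterm (visited⇒region r) term) } }

    -- The descending return path puts the body at least as high as the entry. Eliminating the loop
    -- therefore removes no descending transition.
    ¬down-enters : ∀ {x l y} → Down x l y → ¬ Enters ℓ x l y
    ¬down-enters (_ , y<x) (refl , _ , refl) = ℕ.<⇒≱ y<x (↘*⇒≥ returns)

    kept : ∀ {x l y} → start ⇝[ ℓ ∷ ls ] x → Remaining ls x l y → Kept D loopSub x l y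
    kept reach (inj₁ d) = complete reach (inj₁ d) , ¬down-enters d
    kept reach (inj₂ a) =
      complete reach (inj₂ (there a)) ,
      λ { (refl , _) → ∉-later later∉ (Any.map proj₁ a) entry∈ }

    keep-later : ∀ {x l y} → Remaining ls x l y → Remaining (ℓ ∷ ls) x l y
    keep-later = [ inj₁ , inj₂ ∘ there ]′

    ⇝⇒kept : ∀ {x y} → start ⇝[ ℓ ∷ ls ] x → x ⇝[ ls ] y →
             Star (λ x y → ∃[ l ] Kept D loopSub x l y) x y
    ⇝⇒kept _ ε = ε
    ⇝⇒kept reach ((l , t) ◅ p) =
      (l , kept reach t) ◅ ⇝⇒kept (reach ◅◅ ((l , keep-later t) ◅ ε)) p

    represents : Represents (eliminate D loopSub) ls
    represents = record
      { origin≡ = origin≡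
      ; sound = λ (_ , t , ¬u) → drop (sound t) ¬u
      ; complete = λ reach t →
          subst (λ o → Star (λ x y → ∃[ l ] Kept D loopSub x l y) o _) (sym origin≡) (⇝⇒kept ε reach) ,
          kept (Star.map (λ (l , t) → l , keep-later t) reach) t }
      where
        drop : ∀ {x l y} → Remaining (ℓ ∷ ls) x l y → ¬ Enters ℓ x l y → Remaining ls x l y
        drop (inj₁ d) _ = inj₁ d
        drop (inj₂ (here u)) ¬u = ⊥-elim (¬u u)
        drop (inj₂ (there a)) _ = inj₂ a

    -- Body transitions of `ℓ` that are not first steps start inside the region, where no later loop
    -- has its entry.
    separated : ∀ L′ → EntriesAmong ls L′ → NoEntryInBody (D , loopSub) L′
    separated _ _ _ (first u , ¬u) = ¬u u
    separated _ among u (later r _ _ , _) = ∉-later later∉ (among _ _ _ u) (visited⇒region r)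

  -- The bound `EntriesAmong` strengthens the induction: it is what lets `separated` compare the
  -- head loop with all loops of the recursive call.
  eliminateAll : ∀ {ls} → Nested ls → ∀ {D} → Represents D ls →
    ∃[ D′ ] Σ[ s ∈ Eliminations D D′ ]
      (¬ InfinitePath D′ × Layered s × All (EntriesAmong ls) (loops s))
  eliminateAll [] {D} R = D , [] , (λ p → descend p _ 0 ℕ.≤-refl) , [] , []
    where
      descend : (p : InfinitePath D) → ∀ n i → ¬ (level (vertex p i) < n)
      descend p (suc n) i (s≤s below) with Represents.sound R (step p i)
      ... | inj₁ (_ , lt) = descend p n (suc i) (ℕ.<-≤-trans lt below)
  eliminateAll (S ∷ N) R with eliminateAll N (Step.represents S R)
  ... | D′ , s , finite , layered , among =
    D′ , Step.loopSub S R ∷ s , finite ,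
    All.map (λ {L} → Step.separated S R L) among ∷ layered ,
    (λ _ _ _ → here ∘ proj₁) ∷ All.map (λ m x l y → there ∘ m x l y) among

  isLLEE : ∀ {ls} → Nested ls → (∀ {x l y} → x ⟶⟨ l ⟩ y → Remaining ls x l y) → IsLLEE C
  isLLEE N sound with eliminateAll N (record
    { origin≡ = refl ; sound = sound ; complete = λ _ → Remaining⊆⟶ N })
  ... | D , s , finite , layered , _ = D , s , finite , layered

-- The 1-chart of an expression

-- The occurrences of subexpressions other than products.
Pos : StExp A → Set
Pos 𝟎 = ⊤
Pos 𝟏 = ⊤
Pos (act _) = ⊤
Pos (x + y) = ⊤ ⊎ (Pos x ⊎ Pos y)
Pos (x · y) = Pos x ⊎ Pos y
Pos (x *) = ⊤ ⊎ Pos x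

root : (x : StExp A) → Pos x
root 𝟎 = tt
root 𝟏 = tt
root (act _) = tt
root (x + y) = inj₁ tt
root (x · y) = inj₁ (root x)
root (x *) = inj₁ tt

size : StExp A → ℕ
size 𝟎 = 1
size 𝟏 = 1
size (act _) = 1
size (x + y) = 1 ℕ.+ (size x ℕ.+ size y)
size (x · y) = size x ℕ.+ size y
size (x *) = 1 ℕ.+ size x

Fin↔Pos : (x : StExp A) → Fin (size x) ↔ Pos x
Fin↔Pos 𝟎 = 1↔⊤
Fin↔Pos 𝟏 = 1↔⊤
Fin↔Pos (act _) = 1↔⊤
Fin↔Pos (x + y) = (1↔⊤ ⊎-↔ ((Fin↔Pos x ⊎-↔ Fin↔Pos y) ↔-∘ +↔⊎)) ↔-∘ +↔⊎
Fin↔Pos (x · y) = (Fin↔Pos x ⊎-↔ Fin↔Pos y) ↔-∘ +↔⊎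
Fin↔Pos (x *) = (1↔⊤ ⊎-↔ Fin↔Pos x) ↔-∘ +↔⊎

-- The transitions from the position p of x, where ι embeds the positions of x
-- into the vertices V and k is the vertex at which x is left.
edges : {V : Set} (x : StExp A) → (Pos x → V) → V → Pos x → List (Label A × V)
edges 𝟎 ι k _ = []
edges 𝟏 ι k _ = (one , k) ∷ []
edges (act a) ι k _ = (proper a , k) ∷ []
edges (x + y) ι k (inj₁ _) = (one , ι (inj₂ (inj₁ (root x)))) ∷ (one , ι (inj₂ (inj₂ (root y)))) ∷ []
edges (x + y) ι k (inj₂ (inj₁ p)) = edges x (ι ∘ inj₂ ∘ inj₁) k p
edges (x + y) ι k (inj₂ (inj₂ p)) = edges y (ι ∘ inj₂ ∘ inj₂) k p
edges (x · y) ι k (inj₁ p) = edges x (ι ∘ inj₁) (ι (inj₂ (root y))) p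
edges (x · y) ι k (inj₂ p) = edges y (ι ∘ inj₂) k p
edges (x *) ι k (inj₁ _) = (one , ι (inj₂ (root x))) ∷ (one , k) ∷ []
edges (x *) ι k (inj₂ p) = edges x (ι ∘ inj₂) (ι (inj₁ tt)) p

-- Locality. In a star the body is left only to the star vertex, so the occurrences within a star
-- form a region closed away from its entry.
edges⊆ : ∀ {V : Set} (x : StExp A) {ι : Pos x → V} {k} p {l y} → (l , y) ∈ edges x ι k p →
         (∃[ q ] y ≡ ι q) ⊎ y ≡ k
edges⊆ 𝟏 p (here refl) = inj₂ refl
edges⊆ (act _) p (here refl) = inj₂ refl
edges⊆ (x + y) (inj₁ _) (here refl) = inj₁ (_ , refl)
edges⊆ (x + y) (inj₁ _) (there (here refl)) = inj₁ (_ , refl)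
edges⊆ (x + y) (inj₂ (inj₁ p)) t with edges⊆ x p t
... | inj₁ (_ , eq) = inj₁ (_ , eq)
... | inj₂ eq = inj₂ eq
edges⊆ (x + y) (inj₂ (inj₂ p)) t with edges⊆ y p t
... | inj₁ (_ , eq) = inj₁ (_ , eq)
... | inj₂ eq = inj₂ eq
edges⊆ (x · y) (inj₁ p) t with edges⊆ x p t
... | inj₁ (_ , eq) = inj₁ (_ , eq)
... | inj₂ eq = inj₁ (_ , eq)
edges⊆ (x · y) (inj₂ p) t with edges⊆ y p t
... | inj₁ (_ , eq) = inj₁ (_ , eq)
... | inj₂ eq = inj₂ eq
edges⊆ (x *) (inj₁ _) (here refl) = inj₁ (_ , refl)
edges⊆ (x *) (inj₁ _) (there (here refl)) = inj₂ refl
edges⊆ (x *) (inj₂ p) t with edges⊆ x p t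
... | inj₁ (_ , eq) = inj₁ (_ , eq)
... | inj₂ eq = inj₁ (_ , eq)

-- n is the height of the vertex at which x is left, and c n that of an action.
-- With c = suc, heights decrease along all transitions except those from a star
-- to its body; with c = const 0, they decrease along all 1-transitions, provided
-- that bodies of stars do not terminate immediately.
height : (ℕ → ℕ) → (x : StExp A) → ℕ → Pos x → ℕ
height c 𝟎 n _ = 0
height c 𝟏 n _ = suc n
height c (act _) n _ = c n
height c (x + y) n (inj₁ _) = suc (height c x n (root x) ⊔ height c y n (root y))
height c (x + y) n (inj₂ (inj₁ p)) = height c x n p
height c (x + y) n (inj₂ (inj₂ p)) = height c y n p
height c (x · y) n (inj₁ p) = height c x (height c y n (root y)) p
height c (x · y) n (inj₂ p) = height c y n p
height c (x *) n (inj₁ _) = suc (n ⊔ height c x 0 (root x))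
height c (x *) n (inj₂ p) = height c x (suc (n ⊔ height c x 0 (root x))) p

-- With `c = const 0` an action hides the height of the exit, and a guarded expression cannot reach
-- its exit without passing one. Hence the placeholder exit height `0` in the clause of `height` for
-- stars is harmless; the real exit of the body is the star itself, which would be circular.
height-root-guarded : (x : StExp A) → ¬ (x ↓) → ∀ n m →
                      height (const 0) x n (root x) ≡ height (const 0) x m (root x)
height-root-guarded 𝟎 g n m = refl
height-root-guarded 𝟏 g n m = ⊥-elim (g 𝟏↓)
height-root-guarded (act _) g n m = refl
height-root-guarded (x + y) g n m =
  cong₂ (λ i j → suc (i ⊔ j)) (height-root-guarded x (g ∘ +↓ˡ) n m) (height-root-guarded y (g ∘ +↓ʳ) n m)
height-root-guarded (x · y) g n m with x ↓?
... | no ¬x↓ = height-root-guarded x ¬x↓ _ _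
... | yes x↓ = cong (λ i → height (const 0) x i (root x)) (height-root-guarded y (λ y↓ → g (·↓ x↓ y↓)) n m)
height-root-guarded (x *) g n m = ⊥-elim (g *↓)

module Chart {A : Set} (E : StExp A) where

  Vertex : Set
  Vertex = ⊤ ⊎ Pos E

  end : Vertex
  end = inj₁ tt

  out : Vertex → List (Label A × Vertex)
  out (inj₁ _) = []
  out (inj₂ p) = edges E inj₂ end p

  Vertex↔Fin : Vertex ↔ Fin (suc (size E))
  Vertex↔Fin = ↔-sym ((1↔⊤ ⊎-↔ Fin↔Pos E) ↔-∘ +↔⊎)

  -- Termination is concentrated in the extra vertex `end`, so regions made of positions satisfy
  -- `L3`.
  chart : 1-Chart A
  chart = record
    { V = Vertex
    ; V-finite = _ , Vertex↔Fin
    ; start = inj₂ (root E)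
    ; _⟶⟨_⟩_ = λ x l y → (l , y) ∈ out x
    ; Term = _≡ end
    ; Term? = λ { (inj₁ _) → yes refl ; (inj₂ _) → no λ () }
    ; ⟶-finite = λ v → out v , λ _ _ → mk⇔ id id }

  open 1-Chart chart using (_⟶⟨_⟩_; start; WeaklyGuarded)

  heightᵥ : (ℕ → ℕ) → Vertex → ℕ
  heightᵥ c (inj₁ _) = 0
  heightᵥ c (inj₂ p) = height c E 0 p

  open Elimination chart (inj⇒≟ (↔⇒↣ Vertex↔Fin)) (heightᵥ suc)

  -- The invariant for inductions on subexpressions: everything takes place in the single chart of
  -- `E`, with `x` occurring at `ι` and left at `k`.
  record Placed (x : StExp A) (ι : Pos x → Vertex) (k : Vertex) : Set where
    field
      out≡      : ∀ p → out (ι p) ≡ edges x ι k p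
      height≡   : ∀ c p → heightᵥ c (ι p) ≡ height c x (heightᵥ c k) p
      injective : ∀ {p q} → ι p ≡ ι q → p ≡ q
      ≢end      : ∀ p → ι p ≢ end

    ⟶⇒edge : ∀ {p l y} → ι p ⟶⟨ l ⟩ y → (l , y) ∈ edges x ι k p
    ⟶⇒edge {p} = subst (_ ∈_) (out≡ p)

    edge⇒⟶ : ∀ p {l y} → (l , y) ∈ edges x ι k p → ι p ⟶⟨ l ⟩ y
    edge⇒⟶ p = subst (_ ∈_) (sym (out≡ p))

  open Placed

  placed-E : Placed E inj₂ end
  placed-E = record
    { out≡ = λ _ → refl ; height≡ = λ _ _ → refl ; injective = inj₂-injective ; ≢end = λ _ () }

  module _ {x y ι k} (P : Placed (x + y) ι k) where

    placed-+ˡ : Placed x (ι ∘ inj₂ ∘ inj₁) k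
    placed-+ˡ = record
      { out≡ = out≡ P ∘ inj₂ ∘ inj₁
      ; height≡ = λ c → height≡ P c ∘ inj₂ ∘ inj₁
      ; injective = inj₁-injective ∘ inj₂-injective ∘ injective P
      ; ≢end = ≢end P ∘ inj₂ ∘ inj₁ }

    placed-+ʳ : Placed y (ι ∘ inj₂ ∘ inj₂) k
    placed-+ʳ = record
      { out≡ = out≡ P ∘ inj₂ ∘ inj₂
      ; height≡ = λ c → height≡ P c ∘ inj₂ ∘ inj₂
      ; injective = inj₂-injective ∘ inj₂-injective ∘ injective P
      ; ≢end = ≢end P ∘ inj₂ ∘ inj₂ }

    +-root↘ˡ : ∀ c → heightᵥ c (ι (inj₂ (inj₁ (root x)))) < heightᵥ c (ι (inj₁ tt))
    +-root↘ˡ c = subst₂ _<_ (sym (height≡ P c _)) (sym (height≡ P c _)) (s≤s (ℕ.m≤m⊔n _ _))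

    +-root↘ʳ : ∀ c → heightᵥ c (ι (inj₂ (inj₂ (root y)))) < heightᵥ c (ι (inj₁ tt))
    +-root↘ʳ c =
      subst₂ _<_ (sym (height≡ P c _)) (sym (height≡ P c _)) (s≤s (ℕ.m≤n⊔m (height c x _ (root x)) _))

  module _ {x y ι k} (P : Placed (x · y) ι k) where

    placed-·ˡ : Placed x (ι ∘ inj₁) (ι (inj₂ (root y)))
    placed-·ˡ = record
      { out≡ = out≡ P ∘ inj₁
      ; height≡ = λ c p →
          trans (height≡ P c (inj₁ p)) (cong (λ n → height c x n p) (sym (height≡ P c (inj₂ (root y)))))
      ; injective = inj₁-injective ∘ injective P
      ; ≢end = ≢end P ∘ inj₁ }

    placed-·ʳ : Placed y (ι ∘ inj₂) k
    placed-·ʳ = record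
      { out≡ = out≡ P ∘ inj₂
      ; height≡ = λ c → height≡ P c ∘ inj₂
      ; injective = inj₂-injective ∘ injective P
      ; ≢end = ≢end P ∘ inj₂ }

  module _ {x ι k} (P : Placed (x *) ι k) where

    placed-* : Placed x (ι ∘ inj₂) (ι (inj₁ tt))
    placed-* = record
      { out≡ = out≡ P ∘ inj₂
      ; height≡ = λ c p →
          trans (height≡ P c (inj₂ p)) (cong (λ n → height c x n p) (sym (height≡ P c (inj₁ tt))))
      ; injective = inj₂-injective ∘ injective P
      ; ≢end = ≢end P ∘ inj₂ }

    *-root↘ : ∀ c → heightᵥ c k < heightᵥ c (ι (inj₁ tt))
    *-root↘ c = subst (heightᵥ c k <_) (sym (height≡ P c _)) (s≤s (ℕ.m≤m⊔n _ _))

  𝟏-root↘ : ∀ {ι k} → Placed 𝟏 ι k → ∀ c → heightᵥ c k < heightᵥ c (ι tt)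
  𝟏-root↘ P c = subst (_ <_) (sym (height≡ P c tt)) ℕ.≤-refl

  act-root↘ : ∀ {a ι k} → Placed (act a) ι k → heightᵥ suc k < heightᵥ suc (ι tt)
  act-root↘ P = subst (_ <_) (sym (height≡ P suc tt)) ℕ.≤-refl

  one-descends : ∀ {x ι k} → Normal x → Placed x ι k → ∀ p {y} → (one , y) ∈ edges x ι k p →
                 heightᵥ (const 0) y < heightᵥ (const 0) (ι p)
  one-descends 𝟏 P p (here refl) = 𝟏-root↘ P _
  one-descends act P p (here ())
  one-descends act P p (there ())
  one-descends (n + m) P (inj₁ _) (here refl) = +-root↘ˡ P _
  one-descends (n + m) P (inj₁ _) (there (here refl)) = +-root↘ʳ P _
  one-descends (n + m) P (inj₂ (inj₁ p)) t = one-descends n (placed-+ˡ P) p t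
  one-descends (n + m) P (inj₂ (inj₂ p)) t = one-descends m (placed-+ʳ P) p t
  one-descends (mul _ n m) P (inj₁ p) t = one-descends n (placed-·ˡ P) p t
  one-descends (mul _ n m) P (inj₂ p) t = one-descends m (placed-·ʳ P) p t
  one-descends {x = x *} {k = k} (star g _ n) P (inj₁ _) (here refl) =
    -- The height of the star uses exit height `0` for the body, whereas the body is placed with the
    -- star as its exit; guardedness makes the two root heights equal.
    subst₂ _<_
      (trans (height-root-guarded x g 0 _) (sym (height≡ P _ _))) (sym (height≡ P _ _))
      (s≤s (ℕ.m≤n⊔m (heightᵥ (const 0) k) _))
  one-descends (star _ _ n) P (inj₁ _) (there (here refl)) = *-root↘ P _
  one-descends (star _ _ n) P (inj₂ p) t = one-descends n (placed-* P) p t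

  weaklyGuarded : Normal E → WeaklyGuarded
  weaklyGuarded N v cycle = ℕ.<-irrefl refl (descends cycle)
    where
      step : ∀ v {w} → v ⟶⟨ one ⟩ w → heightᵥ (const 0) w < heightᵥ (const 0) v
      step (inj₂ p) t = one-descends N placed-E p t
      descends : ∀ {v w} → TransClosure (_⟶⟨ one ⟩_) v w → heightᵥ (const 0) w < heightᵥ (const 0) v
      descends {v} [ t ] = step v t
      descends {v} (t ∷ p) = ℕ.<-trans (descends p) (step v t)

  -- Loops of the chart

  -- A star can be left at once without entering its body, so exiting needs only descending
  -- transitions. These paths serve as returns of loops and as access to second factors.
  exit-path : ∀ {x ι k} → Exits x → Placed x ι k → Star _↘_ (ι (root x)) k
  exit-path 𝟏 P = (_ , edge⇒⟶ P tt (here refl) , 𝟏-root↘ P suc) ◅ ε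
  exit-path act P = (_ , edge⇒⟶ P tt (here refl) , act-root↘ P) ◅ ε
  exit-path (inˡ ex) P = (_ , edge⇒⟶ P (inj₁ tt) (here refl) , +-root↘ˡ P suc) ◅ exit-path ex (placed-+ˡ P)
  exit-path (inʳ ex) P = (_ , edge⇒⟶ P (inj₁ tt) (there (here refl)) , +-root↘ʳ P suc) ◅ exit-path ex (placed-+ʳ P)
  exit-path (ex₁ · ex₂) P = exit-path ex₁ (placed-·ˡ P) ◅◅ exit-path ex₂ (placed-·ʳ P)
  exit-path _* P = (_ , edge⇒⟶ P (inj₁ tt) (there (here refl)) , *-root↘ P suc) ◅ ε

  -- Inner loops precede outer ones.
  loopsOf : (x : StExp A) → (Pos x → Vertex) → List Loop → List Loop
  loopsOf 𝟎 ι rest = rest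
  loopsOf 𝟏 ι rest = rest
  loopsOf (act _) ι rest = rest
  loopsOf (x + y) ι rest = loopsOf x (ι ∘ inj₂ ∘ inj₁) (loopsOf y (ι ∘ inj₂ ∘ inj₂) rest)
  loopsOf (x · y) ι rest = loopsOf x (ι ∘ inj₁) (loopsOf y (ι ∘ inj₂) rest)
  loopsOf (x *) ι rest =
    loopsOf x (ι ∘ inj₂) (record { entry = ι (inj₁ tt) ; body = ι (inj₂ (root x)) } ∷ rest)

  loopsOf-⊇ : ∀ {Q : Loop → Set} x {ι rest} → Any Q rest → Any Q (loopsOf x ι rest)
  loopsOf-⊇ 𝟎 a = a
  loopsOf-⊇ 𝟏 a = a
  loopsOf-⊇ (act _) a = a
  loopsOf-⊇ (x + y) a = loopsOf-⊇ x (loopsOf-⊇ y a)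
  loopsOf-⊇ (x · y) a = loopsOf-⊇ x (loopsOf-⊇ y a)
  loopsOf-⊇ (x *) a = loopsOf-⊇ x (there a)

  loopsOf-entries : ∀ {Q : Vertex → Set} x {ι rest} → (∀ p → Q (ι p)) → All (Q ∘ entry) rest →
                    All (Q ∘ entry) (loopsOf x ι rest)
  loopsOf-entries 𝟎 q a = a
  loopsOf-entries 𝟏 q a = a
  loopsOf-entries (act _) q a = a
  loopsOf-entries (x + y) q a =
    loopsOf-entries x (q ∘ inj₂ ∘ inj₁) (loopsOf-entries y (q ∘ inj₂ ∘ inj₂) a)
  loopsOf-entries (x · y) q a = loopsOf-entries x (q ∘ inj₁) (loopsOf-entries y (q ∘ inj₂) a)
  loopsOf-entries (x *) q a = loopsOf-entries x (q ∘ inj₂) (q (inj₁ tt) ∷ a)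

  edge⇒remaining : ∀ x {ι k} rest → Placed x ι k → ∀ p {l y} → (l , y) ∈ edges x ι k p →
                   Remaining (loopsOf x ι rest) (ι p) l y
  edge⇒remaining 𝟏 rest P p t@(here refl) = inj₁ (edge⇒⟶ P p t , 𝟏-root↘ P suc)
  edge⇒remaining (act _) rest P p t@(here refl) = inj₁ (edge⇒⟶ P p t , act-root↘ P)
  edge⇒remaining (x + y) rest P p@(inj₁ _) t@(here refl) = inj₁ (edge⇒⟶ P p t , +-root↘ˡ P suc)
  edge⇒remaining (x + y) rest P p@(inj₁ _) t@(there (here refl)) = inj₁ (edge⇒⟶ P p t , +-root↘ʳ P suc)
  edge⇒remaining (x + y) rest P (inj₂ (inj₁ p)) t = edge⇒remaining x _ (placed-+ˡ P) p t
  edge⇒remaining (x + y) rest P (inj₂ (inj₂ p)) t =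
    [ inj₁ , inj₂ ∘ loopsOf-⊇ x ]′ (edge⇒remaining y rest (placed-+ʳ P) p t)
  edge⇒remaining (x · y) rest P (inj₁ p) t = edge⇒remaining x _ (placed-·ˡ P) p t
  edge⇒remaining (x · y) rest P (inj₂ p) t =
    [ inj₁ , inj₂ ∘ loopsOf-⊇ x ]′ (edge⇒remaining y rest (placed-·ʳ P) p t)
  edge⇒remaining (x *) rest P (inj₁ _) (here refl) = inj₂ (loopsOf-⊇ x (here (refl , refl , refl)))
  edge⇒remaining (x *) rest P p@(inj₁ _) t@(there (here refl)) = inj₁ (edge⇒⟶ P p t , *-root↘ P suc)
  edge⇒remaining (x *) rest P (inj₂ p) t = edge⇒remaining x _ (placed-* P) p t

  ⇝-loopsOf : ∀ {v w} x {ι rest} → v ⇝[ rest ] w → v ⇝[ loopsOf x ι rest ] w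
  ⇝-loopsOf x = Star.map (λ (l , t) → l , [ inj₁ , inj₂ ∘ loopsOf-⊇ x ]′ t)

  ⇝-↘* : ∀ {ls u v w} → u ⇝[ ls ] v → Star _↘_ v w → u ⇝[ ls ] w
  ⇝-↘* p q = p ◅◅ Star.map (λ (l , d) → l , inj₁ d) q

  inj₁≢inj₂ : ∀ {X Y : Set} {x : X} {y : Y} → inj₁ x ≢ inj₂ y
  inj₁≢inj₂ ()

  -- `rest` lists the loops eliminated after those of `x`. `fresh` keeps their entries outside the
  -- occurrence of `x`, which yields `later∉`; `reach` may pass through them, as they are still
  -- present.
  nested : ∀ {x ι k rest} → Normal x → Placed x ι k → Nested rest →
           All (λ ℓ → ∀ p → entry ℓ ≢ ι p) rest → start ⇝[ rest ] ι (root x) →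
           Nested (loopsOf x ι rest)
  nested 𝟎 P N fresh reach = N
  nested 𝟏 P N fresh reach = N
  nested act P N fresh reach = N
  nested {x + y} (n + m) P N fresh reach =
    nested n (placed-+ˡ P)
      (nested m (placed-+ʳ P) N (All.map (λ ne → ne ∘ inj₂ ∘ inj₂) fresh)
        (⇝-↘* reach ((_ , edge⇒⟶ P (inj₁ tt) (there (here refl)) , +-root↘ʳ P suc) ◅ ε)))
      (loopsOf-entries y (λ q p eq → inj₁≢inj₂ (sym (inj₂-injective (injective P eq))))
        (All.map (λ ne → ne ∘ inj₂ ∘ inj₁) fresh))
      (⇝-loopsOf y (⇝-↘* reach ((_ , edge⇒⟶ P (inj₁ tt) (here refl) , +-root↘ˡ P suc) ◅ ε)))
  nested {x · y} (mul ex n m) P N fresh reach =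
    nested n (placed-·ˡ P)
      (nested m (placed-·ʳ P) N (All.map (λ ne → ne ∘ inj₂) fresh)
        (⇝-↘* reach (exit-path ex (placed-·ˡ P))))
      (loopsOf-entries y (λ q p eq → inj₁≢inj₂ (sym (injective P eq))) (All.map (λ ne → ne ∘ inj₁) fresh))
      (⇝-loopsOf y reach)
  nested {x *} {ι} {k} {rest} (star g ex n) P N fresh reach =
    nested n (placed-* P) (eliminable ∷ N)
      ((λ p eq → inj₁≢inj₂ (injective P eq)) ∷ All.map (λ ne → ne ∘ inj₂) fresh)
      -- While the inner loops are eliminated, the body is reached through the entry transition of
      -- the enclosing star.
      (reach′ ◅◅ ((one , inj₂ (here (refl , refl , refl))) ◅ ε))
    where
      ℓ = record { entry = ι (inj₁ tt) ; body = ι (inj₂ (root x)) }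
      reach′ : start ⇝[ ℓ ∷ rest ] ι (inj₁ tt)
      reach′ = Star.map (λ (l , t) → l , [ inj₁ , inj₂ ∘ there ]′ t) reach
      closed : ∀ {v l w} → ∃[ p ] v ≡ ι p → v ≢ ι (inj₁ tt) → v ⟶⟨ l ⟩ w → ∃[ q ] w ≡ ι q
      closed (inj₁ _ , refl) ne t = ⊥-elim (ne refl)
      closed (inj₂ p , refl) ne t with edges⊆ x p (⟶⇒edge (placed-* P) t)
      ... | inj₁ (_ , eq) = _ , eq
      ... | inj₂ eq = _ , eq
      eliminable : Eliminable ℓ rest
      eliminable = record
        { Region = λ v → ∃[ p ] v ≡ ι p
        ; entry∈ = _ , refl
        ; body∈ = _ , refl
        ; closed = closed
        ; nonterm = λ { (p , refl) → ≢end P p }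
        ; later∉ = All.map (λ ne (p , eq) → ne p eq) fresh
        ; enters = edge⇒⟶ P (inj₁ tt) (here refl)
        ; returns = exit-path ex (placed-* P)
        ; reachable = reach′ }

  chart-isLLEE : Normal E → IsLLEE chart
  chart-isLLEE N = isLLEE (nested N placed-E [] [] ε) remaining
    where
      remaining : ∀ {x l y} → x ⟶⟨ l ⟩ y → Remaining (loopsOf E inj₂ []) x l y
      remaining {inj₂ p} t = edge⇒remaining E [] placed-E p t

-- Solutions

module Solutions {A : Set} (Γ : Pred (Eq A) 0ℓ) where
  open Provability Γ
  open SetoidReasoning setoid

  -- κ is the value at the vertex at which x is left.
  solution : (x : StExp A) → StExp A → Pos x → StExp A
  solution 𝟎 κ _ = 𝟎
  solution 𝟏 κ _ = 𝟏 · κ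
  solution (act a) κ _ = act a · κ
  solution (x + y) κ (inj₁ _) = (x + y) · κ
  solution (x + y) κ (inj₂ (inj₁ p)) = solution x κ p
  solution (x + y) κ (inj₂ (inj₂ p)) = solution y κ p
  solution (x · y) κ (inj₁ p) = solution x (y · κ) p
  solution (x · y) κ (inj₂ p) = solution y κ p
  solution (x *) κ (inj₁ _) = x * · κ
  solution (x *) κ (inj₂ p) = solution x (x * · κ) p

  solution-root : ∀ x κ → solution x κ (root x) ≈ x · κ
  solution-root 𝟎 κ = ⊢-sym (mil (·-zeroˡ κ))
  solution-root 𝟏 κ = ⊢-refl
  solution-root (act _) κ = ⊢-refl
  solution-root (x + y) κ = ⊢-refl
  solution-root (x · y) κ = ⊢-trans (solution-root x (y · κ)) (⊢-sym (mil (·-assoc x y κ)))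
  solution-root (x *) κ = ⊢-refl

  derivative : {V : Set} → (V → StExp A) → Label A × V → StExp A
  derivative s (l , w) = ⌜ l ⌝ · s w

  step₁ : ∀ {V : Set} (s : V → StExp A) v {l x} → s v ≈ x →
          sum (map (derivative s) ((l , v) ∷ [])) ≈ ⌜ l ⌝ · x
  step₁ s v p = ⊢-trans (mil (+-neut _)) (·-cong ⊢-refl p)

  step₂ : ∀ {V : Set} (s : V → StExp A) v w {x y} → s v ≈ x → s w ≈ y →
          sum (map (derivative s) ((one , v) ∷ (one , w) ∷ [])) ≈ x + y
  step₂ s v w p q =
    +-cong (⊢-trans (mil (·-idˡ _)) p) (⊢-trans (step₁ s w q) (mil (·-idˡ _)))

  star-equation : ∀ x κ → x * · κ ≈ x · (x * · κ) + κ
  star-equation x κ = begin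
    x * · κ                   ≈⟨ ·-cong (mil (*-unfold x)) ⊢-refl ⟩
    (𝟏 + x · x *) · κ         ≈⟨ mil (+-distʳ 𝟏 (x · x *) κ) ⟩
    𝟏 · κ + (x · x *) · κ     ≈⟨ +-cong (mil (·-idˡ κ)) (mil (·-assoc x (x *) κ)) ⟩
    κ + x · (x * · κ)         ≈⟨ mil (+-comm _ _) ⟩
    x · (x * · κ) + κ         ∎

  -- Agreement of `s` with `solution` is only up to `≈`, and `κ` is arbitrary. Thus the body of a
  -- star can be solved relative to any value chosen at the star vertex.
  solution-equation : ∀ {V : Set} (s : V → StExp A) x {ι k κ} →
    (∀ p → s (ι p) ≈ solution x κ p) → s k ≈ κ →
    ∀ p → solution x κ p ≈ sum (map (derivative s) (edges x ι k p))
  solution-equation s 𝟎 h hₖ p = ⊢-refl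
  solution-equation s 𝟏 h hₖ p = ⊢-sym (step₁ s _ hₖ)
  solution-equation s (act _) h hₖ p = ⊢-sym (step₁ s _ hₖ)
  solution-equation s (x + y) {κ = κ} h hₖ (inj₁ _) =
    ⊢-trans (mil (+-distʳ x y κ))
      (⊢-sym (step₂ s _ _ (⊢-trans (h _) (solution-root x κ)) (⊢-trans (h _) (solution-root y κ))))
  solution-equation s (x + y) h hₖ (inj₂ (inj₁ p)) = solution-equation s x (h ∘ inj₂ ∘ inj₁) hₖ p
  solution-equation s (x + y) h hₖ (inj₂ (inj₂ p)) = solution-equation s y (h ∘ inj₂ ∘ inj₂) hₖ p
  solution-equation s (x · y) {κ = κ} h hₖ (inj₁ p) =
    solution-equation s x (h ∘ inj₁) (⊢-trans (h _) (solution-root y κ)) p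
  solution-equation s (x · y) h hₖ (inj₂ p) = solution-equation s y (h ∘ inj₂) hₖ p
  solution-equation s (x *) {κ = κ} h hₖ (inj₁ _) =
    ⊢-trans (star-equation x κ) (⊢-sym (step₂ s _ _ (⊢-trans (h _) (solution-root x _)) hₖ))
  solution-equation s (x *) h hₖ (inj₂ p) = solution-equation s x (h ∘ inj₂) (h (inj₁ tt)) p

  module _ (E : StExp A) where
    open Chart E

    isSolution : (s : Vertex → StExp A) → s end ≈ 𝟏 →
                 (∀ p → s (inj₂ p) ≈ sum (map (derivative s) (out (inj₂ p)))) →
                 IsSolution chart ((Mil⁻+ Γ) ⊢_) s
    isSolution s s-end s-pos v ts lists = ⊢-trans (equation v) (+-congˡ (⊢-sym ∑ts≈))
      where
        ∑ts≈ : ∑ (map (derivative s) ts) ≈ sum (map (derivative s) (out v))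
        ∑ts≈ = ⊢-trans (∑≈sum (map (derivative s) ts))
          (sum-≋ (derivative s) (Equivalence.to (lists _ _)) (Equivalence.from (lists _ _)))
        equation : ∀ v → s v ≈ τ chart v + sum (map (derivative s) (out v))
        equation (inj₁ _) = ⊢-trans s-end (⊢-sym (mil (+-neut 𝟏)))
        equation (inj₂ p) = ⊢-trans (s-pos p) (⊢-sym (+-neutˡ _))

    coinductiveProof : Normal E → (s₁ s₂ : Vertex → StExp A) →
      IsSolution chart ((Mil⁻+ Γ) ⊢_) s₁ → IsSolution chart ((Mil⁻+ Γ) ⊢_) s₂ →
      Σ[ P ∈ CoinductiveProof ((Mil⁻+ Γ) ⊢_) (s₁ (inj₂ (root E)) ≐ s₂ (inj₂ (root E))) ] LLEE-witnessed P
    coinductiveProof N s₁ s₂ sol₁ sol₂ = record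
      { chart = chart
      ; weaklyGuarded = weaklyGuarded N
      ; L = λ v → s₁ v ≐ s₂ v
      ; solution₁ = sol₁
      ; solution₂ = sol₂
      ; conclusion₁ = refl
      ; conclusion₂ = refl } , chart-isLLEE N

  module Looping (F G : StExp A) where
    open Chart (F * · G)

    looping : StExp A → Vertex → StExp A
    looping h (inj₁ _) = 𝟏
    looping h (inj₂ (inj₁ (inj₁ _))) = h
    looping h (inj₂ (inj₁ (inj₂ p))) = solution F h p
    looping h (inj₂ (inj₂ p)) = solution G 𝟏 p

    looping-isSolution : ∀ {h} → h ≈ F · h + G → IsSolution chart ((Mil⁻+ Γ) ⊢_) (looping h)
    looping-isSolution {h} eq = isSolution (F * · G) (looping h) ⊢-refl λ where
      -- Only at the star vertex is the value free; its two transitions, to `F` and to `G`, yield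
      -- precisely the assumed equation for `h`.
      (inj₁ (inj₁ _)) → ⊢-trans eq (⊢-sym (step₂ (looping h) (inj₂ (inj₁ (inj₂ (root F)))) (inj₂ (inj₂ (root G)))
        (solution-root F h) (⊢-trans (solution-root G 𝟏) (mil (·-idʳ G)))))
      (inj₁ (inj₂ p)) → solution-equation (looping h) F (λ _ → ⊢-refl) ⊢-refl p
      (inj₂ p) → solution-equation (looping h) G (λ _ → ⊢-refl) ⊢-refl p

  -- The factor 𝟏 makes the start vertex one that no transition enters.
  module Straight (H : StExp A) where
    open Chart (𝟏 · H)

    straight : StExp A → Vertex → StExp A
    straight h (inj₁ _) = 𝟏
    straight h (inj₂ (inj₁ _)) = h
    straight h (inj₂ (inj₂ p)) = solution H 𝟏 p

    straight-isSolution : ∀ {h} → h ≈ H → IsSolution chart ((Mil⁻+ Γ) ⊢_) (straight h)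
    straight-isSolution {h} eq = isSolution (𝟏 · H) (straight h) ⊢-refl λ where
      (inj₁ _) → ⊢-trans eq (⊢-sym (⊢-trans (step₁ (straight h) (inj₂ (inj₂ (root H)))
        (⊢-trans (solution-root H 𝟏) (mil (·-idʳ H)))) (mil (·-idˡ H))))
      (inj₂ p) → solution-equation (straight h) H (λ _ → ⊢-refl) ⊢-refl p

  -- Assembling the coinductive proof

  fixpoints-coincide : ∀ {e₁ e₂ f g} → ¬ (f ↓) → e₁ ≈ f · e₁ + g → e₂ ≈ f · e₂ + g →
    Σ[ P ∈ CoinductiveProof ((Mil⁻+ Γ) ⊢_) (e₁ ≐ e₂) ] LLEE-witnessed P
  fixpoints-coincide {e₁} {e₂} {f} {g} ¬f↓ eq₁ eq₂ = cases (exits? F)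
    where
      F = nf (normalise f)
      G = nf (normalise g)
      NF = normal (normalise f)
      NG = normal (normalise g)

      normalised : ∀ {h} → h ≈ f · h + g → h ≈ F · h + G
      normalised eq = ⊢-trans eq
        (⊢-sym (+-cong (·-cong (nf≈ (normalise f)) ⊢-refl) (nf≈ (normalise g))))

      cases : Dec (Exits F) → Σ[ P ∈ CoinductiveProof ((Mil⁻+ Γ) ⊢_) (e₁ ≐ e₂) ] LLEE-witnessed P
      -- The hypothesis on `f` enters here: it makes the star over `F` normal.
      cases (yes ex) = coinductiveProof (F * · G)
        (mul _* (star (¬f↓ ∘ ↓-sound (normalise f)) ex NF) NG) (looping e₁) (looping e₂)
        (looping-isSolution (normalised eq₁)) (looping-isSolution (normalised eq₂))
        where open Looping F G
      cases (no dead) = coinductiveProof (𝟏 · (F + G)) (mul 𝟏 𝟏 (NF + NG)) (straight e₁) (straight e₂)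
        (straight-isSolution (flat eq₁)) (straight-isSolution (flat eq₂))
        where
          open Straight (F + G)
          flat : ∀ {h} → h ≈ f · h + g → h ≈ F + G
          flat eq = ⊢-trans (normalised eq) (+-congʳ (dead-·ˡ NF dead _))

lemma6p3 : (A : Set) (e f g : StExp A) → ¬ (f ↓) →
    Σ[ P ∈ CoinductiveProof ((Mil⁻+ ｛ e ≐ f · e + g ｝) ⊢_) (e ≐ f * · g) ] LLEE-witnessed P
lemma6p3 A e f g ¬f↓ =
  fixpoints-coincide ¬f↓ (axiom (inj₂ refl)) (star-equation f g)
  where open Solutions ｛ e ≐ f · e + g ｝
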